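{- Let $k\ge 2$, let $G$ be a $\Gamma_{\times k,t}$-external graph with $\delta(G)\ge k$, and let $H$ be a graph. (i) If $\delta(H)\ge k+1$, then $\Gamma_{\times k,t}(G\,\Box\,H)\ge\Gamma_{\times k,t}(G)\big(\Gamma_{\times k,t}(H)+\delta(H)-k\big)$. (ii) If $H$ is $k$-regular, then $\Gamma_{\times k,t}(G\,\Box\,H)\ge\Gamma_{\times k,t}(G)\cdot\Gamma_{\times k,t}(H)$.
   Context: A set $S\subseteq V(G)$ is a $k$-tuple total dominating set ($k$TDS) of a graph $G$ with $\delta(G)\ge k$ if $|N_G(x)\cap S|\ge k$ for every $x\in V(G)$. The upper $k$-tuple total domination number $\Gamma_{\times k,t}(G)$ is the maximum cardinality of a minimal (with respect to inclusion) $k$TDS of $G$; a minimal $k$TDS of this cardinality is a $\Gamma_{\times k,t}$-set. For $v\in S$, a vertex $v'$ is a $k$-open private neighbor of $v$ with respect to $S$ if $v\in N_G(v')$ and $|N_G(v')\cap S|=k$; it is external if $v'\notin S$. A graph $G$ is $\Gamma_{\times k,t}$-external if it has a $\Gamma_{\times k,t}$-set $S$ such that every vertex of $S$ has an external $k$-open private neighbor with respect to $S$. The Cartesian product $G\,\Box\,H$ has vertex set $V(G)\times V(H)$, with $(g_1,h_1)\sim(g_2,h_2)$ iff either $g_1=g_2$ and $h_1h_2\in E(H)$, or $h_1=h_2$ and $g_1g_2\in E(G)$. -}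

module Defs where

open import Data.Bool.Base using (true; false)
open import Data.Fin.Base using (Fin; remQuot)
open import Data.Fin.Properties using (_≟_; all?)
open import Data.Fin.Subset using (Subset; _∈_; _∉_; _∩_; _⊂_; ∣_∣)
open import Data.Fin.Subset.Properties using (_⊂?_; anySubset?)
open import Data.List.Base using (List; []; _∷_; _++_; map; filter; allFin)
open import Data.List.Extrema.Nat using (min; max)
open import Data.Nat.Base using (ℕ; zero; suc; _*_; _≥_)
open import Data.Nat.Properties using (_≥?_)
open import Data.Product.Base using (_×_; _,_; ∃-syntax)
open import Data.Sum.Base using (_⊎_; inj₁; inj₂)
open import Data.Vec.Base as Vec using ([]; _∷_)
open import Level using (0ℓ)
open import Relation.Binary.Core using (Rel)
open import Relation.Binary.Definitions using (Decidable; Irreflexive; Symmetric)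
open import Relation.Binary.PropositionalEquality using (_≡_; refl; sym)
open import Relation.Nullary.Decidable
  using (Dec; does; map′; ¬?; _×-dec_; _⊎-dec_)
open import Relation.Nullary.Negation using (¬_)

-- Finite simple graphs.  Adjacency is decidable, so that neighbourhoods are
-- elements of Subset n and degrees and Γ below can be computed.
record Graph (n : ℕ) : Set₁ where
  field
    Adj    : Rel (Fin n) 0ℓ
    adj?   : Decidable Adj
    irrefl : Irreflexive _≡_ Adj
    symm   : Symmetric Adj

open Graph public

private
  variable
    m n : ℕ

N : Graph n → Fin n → Subset n
N G x = Vec.tabulate λ y → does (adj? G x y)

deg : Graph n → Fin n → ℕ
deg G x = ∣ N G x ∣

-- All degrees are < n, so the default value n affects only the null graph,
-- for which it gives δ = 0.
δ : Graph n → ℕ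
δ {n} G = min n (map (deg G) (allFin n))

Regular : ℕ → Graph n → Set
Regular k G = ∀ x → deg G x ≡ k

IsKTDS : ℕ → Graph n → Subset n → Set
IsKTDS k G S = ∀ x → ∣ N G x ∩ S ∣ ≥ k

IsMinimalKTDS : ℕ → Graph n → Subset n → Set
IsMinimalKTDS k G S = IsKTDS k G S × (∀ {T} → T ⊂ S → ¬ IsKTDS k G T)

isKTDS? : ∀ k (G : Graph n) S → Dec (IsKTDS k G S)
isKTDS? k G S = all? λ x → ∣ N G x ∩ S ∣ ≥? k

isMinimalKTDS? : ∀ k (G : Graph n) S → Dec (IsMinimalKTDS k G S)
isMinimalKTDS? k G S =
  isKTDS? k G S ×-dec
  map′ (λ ¬∃ {T} T⊂S dom → ¬∃ (T , T⊂S , dom))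
       (λ min → λ { (T , T⊂S , dom) → min T⊂S dom })
       (¬? (anySubset? λ T → (T ⊂? S) ×-dec isKTDS? k G T))

-- Every subset of Fin n, each listed once.
subsets : ∀ n → List (Subset n)
subsets zero    = [] ∷ []
subsets (suc n) = map (true ∷_) (subsets n) ++ map (false ∷_) (subsets n)

-- Upper k-tuple total domination number.  A minimal kTDS exists whenever
-- δ G ≥ k; the default value 0 is irrelevant in that case.
Γ : ℕ → Graph n → ℕ
Γ {n} k G = max 0 (map ∣_∣ (filter (isMinimalKTDS? k G) (subsets n)))

IsΓSet : ℕ → Graph n → Subset n → Set
IsΓSet k G S = IsMinimalKTDS k G S × ∣ S ∣ ≡ Γ k G

-- v′ is a k-open private neighbour of v with respect to S.
IsPrivateNeighbour : ℕ → Graph n → Subset n → Fin n → Fin n → Set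
IsPrivateNeighbour k G S v v′ = v ∈ N G v′ × ∣ N G v′ ∩ S ∣ ≡ k

IsExternalPrivateNeighbour : ℕ → Graph n → Subset n → Fin n → Fin n → Set
IsExternalPrivateNeighbour k G S v v′ =
  IsPrivateNeighbour k G S v v′ × v′ ∉ S

ΓExternal : ℕ → Graph n → Set
ΓExternal k G =
  ∃[ S ] IsΓSet k G S ×
         (∀ {v} → v ∈ S → ∃[ v′ ] IsExternalPrivateNeighbour k G S v v′)

-- Cartesian product; V(G) × V(H) is represented by Fin (m * n) through the
-- bijection remQuot n : Fin (m * n) → Fin m × Fin n.
□Adj : Graph m → Graph n → Rel (Fin m × Fin n) 0ℓ
□Adj G H (g₁ , h₁) (g₂ , h₂) =
  (g₁ ≡ g₂ × Adj H h₁ h₂) ⊎ (h₁ ≡ h₂ × Adj G g₁ g₂)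

infixr 7 _□_

_□_ : Graph m → Graph n → Graph (m * n)
_□_ {m} {n} G H = record
  { Adj    = λ p q → □Adj G H (remQuot n p) (remQuot n q)
  ; adj?   = λ p q → let (g₁ , h₁) = remQuot {m} n p
                         (g₂ , h₂) = remQuot {m} n q
                     in (g₁ ≟ g₂ ×-dec adj? H h₁ h₂) ⊎-dec
                        (h₁ ≟ h₂ ×-dec adj? G g₁ g₂)
  ; irrefl = λ { refl (inj₁ (_ , a)) → irrefl H refl a
               ; refl (inj₂ (_ , a)) → irrefl G refl a }
  ; symm   = λ { (inj₁ (e , a)) → inj₁ (sym e , symm H a)
               ; (inj₂ (e , a)) → inj₂ (sym e , symm G a) }
  }

{-# OPTIONS --safe #-}
-- Let S be a Γ-set of G all of whose vertices have external k-open private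
-- neighbours.  Then S × V(H) is a minimal kTDS of G □ H: if v′ ∉ S is a private
-- neighbour of v ∈ S, then (v′ , h) has no neighbour in S × V(H) along H, so it
-- is a private neighbour of (v , h).  Hence Γ(G □ H) ≥ Γ(G) · |V(H)|, and it
-- remains to compare |V(H)| with Γ(H).  A nonempty minimal kTDS T of H has a
-- vertex x with at most k neighbours in T, so deg x − k vertices lie outside T
-- and Γ(H) + δ(H) ≤ |V(H)| + k.
module Submission where

open import Defs
open import Data.Bool.Base using (true; false)
open import Data.Fin.Base using (Fin; zero; suc; combine; remQuot; quotient; remainder)
open import Data.Fin.Properties
  using (any?; remQuot-combine; combine-remQuot; combine-injectiveˡ; suc-injective)
open import Data.Fin.Subset
  using (Subset; _∈_; _∉_; _⊆_; _⊂_; _∩_; _-_; ∣_∣)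
open import Data.Fin.Subset.Properties
  using ( nonempty?; Empty-unique; ∣⊥∣≡0; ∣p∣≤n; ∣p∣≤∣x∷p∣; p⊆q⇒∣p∣≤∣q∣; p⊂q⇒∣p∣<∣q∣
        ; x∈p⇒p-x⊂p; x∈p⇒∣p-x∣<∣p∣; x∈p∧x≢y⇒x∈p-y; x∈p∩q⁺; x∈p∩q⁻; drop-there )
open import Data.List.Base using (map; allFin)
import Data.List.Membership.Propositional as List
open import Data.List.Membership.Propositional.Properties
  using (∈-map⁺; ∈-++⁺ˡ; ∈-++⁺ʳ; ∈-filter⁺; ∈-filter⁻; ∈-allFin)
open import Data.List.Extrema.Nat using (xs≤max; max≤v⁺; min≤xs; min≤⊤)
import Data.List.Relation.Unary.Any as Any
open import Data.List.Relation.Unary.All using (lookup; tabulate)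
import Data.List.Relation.Unary.All.Properties as All
open import Data.Nat.Base
  using (ℕ; zero; suc; _+_; _*_; _∸_; _≤_; _<_; _≥_; z≤n; s≤s; s≤s⁻¹)
open import Data.Nat.Properties
  using ( _≤?_; ≤-refl; ≤-trans; ≤-reflexive; ≤-<-trans; <-≤-trans; ≰⇒>; <⇒≱; n≤1+n
        ; m≤n⇒m≤1+n; m≤m+n; +-suc; +-monoʳ-≤; +-monoˡ-≤; *-monoʳ-≤; ∸-monoˡ-≤
        ; m+n≤o⇒m≤o∸n; m∸n+n≡m; m+n∸n≡m; module ≤-Reasoning )
open import Data.Product.Base using (_×_; _,_; proj₁; proj₂; ∃-syntax)
open import Data.Sum.Base using (inj₁; inj₂)
open import Data.Vec.Base as Vec using ([]; _∷_; here; there)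
open import Data.Vec.Properties
  using (lookup-concat; lookup-map; lookup-replicate; lookup∘tabulate; []=⇒lookup; lookup⇒[]=)
open import Function.Base using (_∘_)
open import Relation.Binary.PropositionalEquality
  using (_≡_; _≢_; refl; sym; trans; cong; cong₂; subst; subst₂; module ≡-Reasoning)
open import Relation.Nullary.Decidable using (Dec; yes; no; does; dec-true)
open import Relation.Nullary.Negation using (¬_; contradiction)

private
  variable
    m n k : ℕ

-- Cardinalities of subsets

-- Induction on `p`: when `zero` lies in `p`, injectivity keeps all other images inside
-- `q - f zero`, which is strictly smaller than `q`. Injectivity is asked only on `p` because
-- `quotient` is injective only on subsets of a single layer.
injectiveOn⇒∣p∣≤∣q∣ : (p : Subset m) (q : Subset n) (f : Fin m → Fin n) →
  (∀ {x} → x ∈ p → f x ∈ q) →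
  (∀ {x y} → x ∈ p → y ∈ p → f x ≡ f y → x ≡ y) → ∣ p ∣ ≤ ∣ q ∣
injectiveOn⇒∣p∣≤∣q∣ []          q f maps inj = z≤n
injectiveOn⇒∣p∣≤∣q∣ (false ∷ p) q f maps inj =
  injectiveOn⇒∣p∣≤∣q∣ p q (f ∘ suc) (maps ∘ there)
    λ x∈p y∈p → suc-injective ∘ inj (there x∈p) (there y∈p)
injectiveOn⇒∣p∣≤∣q∣ (true  ∷ p) q f maps inj = ≤-<-trans
  (injectiveOn⇒∣p∣≤∣q∣ p (q - f zero) (f ∘ suc)
    (λ x∈p → x∈p∧x≢y⇒x∈p-y (maps (there x∈p))
      λ eq → contradiction (inj (there x∈p) here eq) λ ())
    λ x∈p y∈p → suc-injective ∘ inj (there x∈p) (there y∈p))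
  (x∈p⇒∣p-x∣<∣p∣ (maps here))

∣x∷p∣≤1+∣p∣ : ∀ x (p : Subset n) → ∣ x ∷ p ∣ ≤ suc ∣ p ∣
∣x∷p∣≤1+∣p∣ false p = n≤1+n _
∣x∷p∣≤1+∣p∣ true  p = ≤-refl

-- Only position `x` may lie in `p` and not in `q`, so it accounts for the single extra element.
-- This measures what a neighbourhood loses when one vertex is deleted.
p⊆q∪⁅x⁆⇒∣p∣≤1+∣q∣ : (p q : Subset n) (x : Fin n) →
  (∀ {y} → y ∈ p → y ≢ x → y ∈ q) → ∣ p ∣ ≤ suc ∣ q ∣
p⊆q∪⁅x⁆⇒∣p∣≤1+∣q∣ (b ∷ p) (c ∷ q) zero sub = ≤-trans (∣x∷p∣≤1+∣p∣ b p)
  (s≤s (≤-trans (p⊆q⇒∣p∣≤∣q∣ λ y∈p → drop-there (sub (there y∈p) λ ())) (∣p∣≤∣x∷p∣ c q)))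
p⊆q∪⁅x⁆⇒∣p∣≤1+∣q∣ (b ∷ p) (c ∷ q) (suc x) sub
  with b | c | sub | p⊆q∪⁅x⁆⇒∣p∣≤1+∣q∣ p q x
                       (λ y∈p y≢x → drop-there (sub (there y∈p) (y≢x ∘ suc-injective)))
... | false | false | _   | ih = ih
... | false | true  | _   | ih = m≤n⇒m≤1+n ih
... | true  | true  | _   | ih = s≤s ih
... | true  | false | sub | ih = contradiction (sub here λ ()) λ ()

∣p∩q∣≤1+∣p∩[q-x]∣ : (p q : Subset n) (x : Fin n) → ∣ p ∩ q ∣ ≤ suc ∣ p ∩ (q - x) ∣
∣p∩q∣≤1+∣p∩[q-x]∣ p q x = p⊆q∪⁅x⁆⇒∣p∣≤1+∣q∣ _ _ x λ y∈ y≢x →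
  let (y∈p , y∈q) = x∈p∩q⁻ p q y∈ in x∈p∩q⁺ (y∈p , x∈p∧x≢y⇒x∈p-y y∈q y≢x)

-- Inclusion-exclusion, with the union bounded by the whole vertex set.
∣p∣+∣q∣≤n+∣q∩p∣ : (p q : Subset n) → ∣ p ∣ + ∣ q ∣ ≤ n + ∣ q ∩ p ∣
∣p∣+∣q∣≤n+∣q∩p∣ []          []          = z≤n
∣p∣+∣q∣≤n+∣q∩p∣ (false ∷ p) (false ∷ q) = m≤n⇒m≤1+n (∣p∣+∣q∣≤n+∣q∩p∣ p q)
∣p∣+∣q∣≤n+∣q∩p∣ (true  ∷ p) (false ∷ q) = s≤s (∣p∣+∣q∣≤n+∣q∩p∣ p q)
∣p∣+∣q∣≤n+∣q∩p∣ (false ∷ p) (true  ∷ q)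
  rewrite +-suc ∣ p ∣ ∣ q ∣ = s≤s (∣p∣+∣q∣≤n+∣q∩p∣ p q)
∣p∣+∣q∣≤n+∣q∩p∣ {n = suc n} (true ∷ p) (true ∷ q)
  rewrite +-suc ∣ p ∣ ∣ q ∣ | +-suc n ∣ q ∩ p ∣ = s≤s (s≤s (∣p∣+∣q∣≤n+∣q∩p∣ p q))

∩-monoʳ-⊂ : {p q r : Subset n} {x : Fin n} →
  q ⊆ r → x ∈ p → x ∈ r → x ∉ q → p ∩ q ⊂ p ∩ r
∩-monoʳ-⊂ {p = p} {q} q⊆r x∈p x∈r x∉q =
  (λ y∈ → let (y∈p , y∈q) = x∈p∩q⁻ p q y∈ in x∈p∩q⁺ (y∈p , q⊆r y∈q)) ,
  _ , x∈p∩q⁺ (x∈p , x∈r) , x∉q ∘ proj₂ ∘ x∈p∩q⁻ p q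

-- Neighbourhoods and extremal values

does-true⇒ : {A : Set} (a? : Dec A) → does a? ≡ true → A
does-true⇒ (yes a) _ = a

∈N⁺ : (G : Graph n) {x y : Fin n} → Adj G x y → y ∈ N G x
∈N⁺ G {x} {y} a =
  lookup⇒[]= y _ (trans (lookup∘tabulate _ y) (dec-true (adj? G x y) a))

∈N⁻ : (G : Graph n) {x y : Fin n} → y ∈ N G x → Adj G x y
∈N⁻ G {x} {y} y∈N =
  does-true⇒ (adj? G x y) (trans (sym (lookup∘tabulate _ y)) ([]=⇒lookup y∈N))

δ≤deg : (G : Graph n) (x : Fin n) → δ G ≤ deg G x
δ≤deg G x = lookup (min≤xs _ _) (∈-map⁺ (deg G) (∈-allFin x))

δ≤n : (G : Graph n) → δ G ≤ n
δ≤n {n} G = min≤⊤ n (map (deg G) (allFin n))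

∈-subsets : (p : Subset n) → p List.∈ subsets n
∈-subsets []          = Any.here refl
∈-subsets (true  ∷ p) = ∈-++⁺ˡ (∈-map⁺ (true ∷_) (∈-subsets p))
∈-subsets (false ∷ p) = ∈-++⁺ʳ _ (∈-map⁺ (false ∷_) (∈-subsets p))

minimalKTDS⇒∣S∣≤Γ : (G : Graph n) {S : Subset n} → IsMinimalKTDS k G S → ∣ S ∣ ≤ Γ k G
minimalKTDS⇒∣S∣≤Γ {k = k} G {S} S-min = lookup (xs≤max 0 _)
  (∈-map⁺ ∣_∣ (∈-filter⁺ (isMinimalKTDS? k G) (∈-subsets S) S-min))

-- The default value 0 of the maximum lies below every `b`, so the bound also covers a graph without
-- minimal kTDS.
Γ≤ : (G : Graph n) {b : ℕ} → (∀ {S} → IsMinimalKTDS k G S → ∣ S ∣ ≤ b) → Γ k G ≤ b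
Γ≤ {k = k} G bound = max≤v⁺ z≤n
  (All.map⁺ (tabulate (bound ∘ proj₂ ∘ ∈-filter⁻ (isMinimalKTDS? k G) {xs = subsets _})))

minimalKTDS⇒∣S∣+δ≤n+k : (H : Graph n) {S : Subset n} →
  IsMinimalKTDS k H S → ∣ S ∣ + δ H ≤ n + k
minimalKTDS⇒∣S∣+δ≤n+k {n} {k} H {S} (_ , minimal)
  with any? (λ x → ∣ N H x ∩ S ∣ ≤? k) | nonempty? S
... | yes (x , tight) | _ = begin
  ∣ S ∣ + δ H          ≤⟨ +-monoʳ-≤ ∣ S ∣ (δ≤deg H x) ⟩
  ∣ S ∣ + deg H x      ≤⟨ ∣p∣+∣q∣≤n+∣q∩p∣ S (N H x) ⟩
  n + ∣ N H x ∩ S ∣    ≤⟨ +-monoʳ-≤ n tight ⟩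
  n + k                ∎
  where open ≤-Reasoning
-- If every vertex has more than `k` neighbours in `S`, deleting `v` costs each of them at most one,
-- so `S - v` is still a kTDS, against minimality.
... | no loose | yes (v , v∈S) = contradiction
  (λ x → s≤s⁻¹ (≤-trans (≰⇒> (loose ∘ (x ,_))) (∣p∩q∣≤1+∣p∩[q-x]∣ (N H x) S v)))
  (minimal (x∈p⇒p-x⊂p v∈S))
-- For empty `S` the claim reduces to `δ H ≤ n + k`.
... | no _ | no empty rewrite Empty-unique empty | ∣⊥∣≡0 n = ≤-trans (δ≤n H) (m≤m+n n k)

Γ+δ≤n+k : (H : Graph n) → Γ k H + δ H ≤ n + k
Γ+δ≤n+k {n} {k} H = begin
  Γ k H + δ H            ≤⟨ +-monoˡ-≤ (δ H) (Γ≤ H λ S-min →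
                              m+n≤o⇒m≤o∸n _ (minimalKTDS⇒∣S∣+δ≤n+k H S-min)) ⟩
  -- The truncated subtraction is exact because `δ H ≤ n`.
  n + k ∸ δ H + δ H      ≡⟨ m∸n+n≡m (≤-trans (δ≤n H) (m≤m+n n k)) ⟩
  n + k                  ∎
  where open ≤-Reasoning

-- The set S × V(H)

-- `combine g h` is position `h` of the block with index `g`, so membership of `g` in `S` is
-- repeated throughout that block.
cylinder : ∀ n → Subset m → Subset (m * n)
cylinder n S = Vec.concat (Vec.map (Vec.replicate n) S)

∣replicate-true++p∣ : ∀ n (p : Subset m) → ∣ Vec.replicate n true Vec.++ p ∣ ≡ n + ∣ p ∣
∣replicate-true++p∣ zero    p = refl
∣replicate-true++p∣ (suc n) p = cong suc (∣replicate-true++p∣ n p)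

∣replicate-false++p∣ : ∀ n (p : Subset m) → ∣ Vec.replicate n false Vec.++ p ∣ ≡ ∣ p ∣
∣replicate-false++p∣ zero    p = refl
∣replicate-false++p∣ (suc n) p = ∣replicate-false++p∣ n p

∣cylinder∣ : ∀ n (S : Subset m) → ∣ cylinder n S ∣ ≡ ∣ S ∣ * n
∣cylinder∣ n []          = refl
∣cylinder∣ n (true  ∷ S) = trans (∣replicate-true++p∣ n _) (cong (n +_) (∣cylinder∣ n S))
∣cylinder∣ n (false ∷ S) = trans (∣replicate-false++p∣ n _) (∣cylinder∣ n S)

lookup-cylinder : (S : Subset m) (g : Fin m) (h : Fin n) →
  Vec.lookup (cylinder n S) (combine g h) ≡ Vec.lookup S g
lookup-cylinder {n = n} S g h = begin
  Vec.lookup (cylinder n S) (combine g h)                        ≡⟨ lookup-concat (Vec.map (Vec.replicate n) S) g h ⟩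
  Vec.lookup (Vec.lookup (Vec.map (Vec.replicate n) S) g) h      ≡⟨ cong (λ r → Vec.lookup r h) (lookup-map g _ S) ⟩
  Vec.lookup (Vec.replicate n (Vec.lookup S g)) h                ≡⟨ lookup-replicate h _ ⟩
  Vec.lookup S g                                                 ∎
  where open ≡-Reasoning

combine∈cylinder⁺ : {S : Subset m} {g : Fin m} (h : Fin n) →
  g ∈ S → combine g h ∈ cylinder n S
combine∈cylinder⁺ {S = S} {g} h g∈S =
  lookup⇒[]= _ _ (trans (lookup-cylinder S g h) ([]=⇒lookup g∈S))

combine∈cylinder⁻ : (S : Subset m) (g : Fin m) (h : Fin n) →
  combine g h ∈ cylinder n S → g ∈ S
combine∈cylinder⁻ S g h ∈cyl =
  lookup⇒[]= g S (trans (sym (lookup-cylinder S g h)) ([]=⇒lookup ∈cyl))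

∈cylinder⁻ : (S : Subset m) {p : Fin (m * n)} → p ∈ cylinder n S → quotient n p ∈ S
∈cylinder⁻ {m} {n} S {p} p∈cyl =
  combine∈cylinder⁻ S _ _ (subst (_∈ cylinder n S) (sym (combine-remQuot {m} n p)) p∈cyl)

module _ (G : Graph m) (H : Graph n) where

  combine-adjˡ : ∀ {g g′} h → Adj G g g′ → Adj (G □ H) (combine g h) (combine g′ h)
  combine-adjˡ {g} {g′} h a = subst₂ (□Adj G H)
    (sym (remQuot-combine g h)) (sym (remQuot-combine g′ h)) (inj₂ (refl , a))

  adj-combine⁻ : ∀ {g h p} → Adj (G □ H) (combine g h) p →
                 □Adj G H (g , h) (remQuot n p)
  adj-combine⁻ {g} {h} {p} =
    subst (λ q → □Adj G H q (remQuot n p)) (remQuot-combine g h)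

  -- The neighbours of `g` in `S` are copied into layer `h`; neighbours along `H` can only add to
  -- the count.
  ∣N∩S∣≤∣N∩cylinder∣ : ∀ S g h →
    ∣ N G g ∩ S ∣ ≤ ∣ N (G □ H) (combine g h) ∩ cylinder n S ∣
  ∣N∩S∣≤∣N∩cylinder∣ S g h = injectiveOn⇒∣p∣≤∣q∣ _ _ (λ g′ → combine g′ h)
    (λ x∈ → let (x∈N , x∈S) = x∈p∩q⁻ (N G g) S x∈ in
      x∈p∩q⁺ (∈N⁺ (G □ H) (combine-adjˡ h (∈N⁻ G x∈N)) , combine∈cylinder⁺ h x∈S))
    (λ _ _ → combine-injectiveˡ _ h _ h)

  cylinder-isKTDS : ∀ {S} → IsKTDS k G S → IsKTDS k (G □ H) (cylinder n S)
  cylinder-isKTDS {k} {S} dom p = subst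
    (λ q → k ≤ ∣ N (G □ H) q ∩ cylinder n S ∣) (combine-remQuot {m} n p)
    (≤-trans (dom g) (∣N∩S∣≤∣N∩cylinder∣ S g h))
    where
    g = quotient {m} n p
    h = remainder {m} n p

  module _ {S : Subset m} {g : Fin m} (g∉S : g ∉ S) (h : Fin n) where

    -- A neighbour along `H` has first coordinate `g`, which is outside `S`. So only neighbours
    -- along `G` remain, and these stay in layer `h`.
    ∈N∩cylinder⁻ : ∀ {p} → p ∈ N (G □ H) (combine g h) ∩ cylinder n S →
                   quotient n p ∈ N G g ∩ S × remainder {m} n p ≡ h
    ∈N∩cylinder⁻ p∈ with x∈p∩q⁻ (N (G □ H) (combine g h)) (cylinder n S) p∈
    ... | p∈N , p∈cyl with adj-combine⁻ (∈N⁻ (G □ H) p∈N)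
    ... | inj₁ (g≡ , _)  = contradiction (subst (_∈ S) (sym g≡) (∈cylinder⁻ S p∈cyl)) g∉S
    ... | inj₂ (h≡ , a) = x∈p∩q⁺ (∈N⁺ G a , ∈cylinder⁻ S p∈cyl) , sym h≡

    ∣N∩cylinder∣≤∣N∩S∣ : ∣ N (G □ H) (combine g h) ∩ cylinder n S ∣ ≤ ∣ N G g ∩ S ∣
    -- All vertices counted have second coordinate `h`, so the first coordinate determines them.
    ∣N∩cylinder∣≤∣N∩S∣ = injectiveOn⇒∣p∣≤∣q∣ _ _ (quotient n)
      (proj₁ ∘ ∈N∩cylinder⁻)
      λ {p} {q} p∈ q∈ eq → begin
        p                                               ≡⟨ combine-remQuot {m} n p ⟨
        combine (quotient {m} n p) (remainder {m} n p)  ≡⟨ cong₂ combine eq (trans (proj₂ (∈N∩cylinder⁻ p∈)) (sym (proj₂ (∈N∩cylinder⁻ q∈)))) ⟩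
        combine (quotient {m} n q) (remainder {m} n q)  ≡⟨ combine-remQuot {m} n q ⟩
        q                                               ∎
      where open ≡-Reasoning

  cylinder-isMinimalKTDS : ∀ {S} → IsKTDS k G S →
    (∀ {v} → v ∈ S → ∃[ v′ ] IsExternalPrivateNeighbour k G S v v′) →
    IsMinimalKTDS k (G □ H) (cylinder n S)
  cylinder-isMinimalKTDS {k} {S} dom external = cylinder-isKTDS dom , minimal
    where
    minimal : ∀ {T} → T ⊂ cylinder n S → ¬ IsKTDS k (G □ H) T
    minimal {T} (T⊆cyl , p , p∈cyl , p∉T) T-dom
      with external (∈cylinder⁻ S p∈cyl)
    -- The private neighbour `v′` of the first coordinate of `p`, placed in the layer of `p`, has at
    -- most `k` neighbours in the cylinder. One of them is `p`, which `T` lacks, so fewer than `k`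
    -- lie in `T`.
    ... | v′ , (v∈N , tight) , v′∉S = <⇒≱ lt (T-dom x)
      where
      h = remainder {m} n p
      x = combine v′ h

      p∈N : p ∈ N (G □ H) x
      p∈N = subst (_∈ N (G □ H) x) (combine-remQuot {m} n p)
              (∈N⁺ (G □ H) (combine-adjˡ h (∈N⁻ G v∈N)))

      lt : ∣ N (G □ H) x ∩ T ∣ < k
      lt = <-≤-trans (p⊂q⇒∣p∣<∣q∣ (∩-monoʳ-⊂ T⊆cyl p∈N p∈cyl p∉T))
             (≤-trans (∣N∩cylinder∣≤∣N∩S∣ v′∉S h) (≤-reflexive tight))

  ΓExternal⇒Γ*n≤Γ□ : ΓExternal k G → Γ k G * n ≤ Γ k (G □ H)
  ΓExternal⇒Γ*n≤Γ□ {k} (S , ((dom , _) , ∣S∣≡Γ) , external) = begin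
    Γ k G * n         ≡⟨ cong (_* n) ∣S∣≡Γ ⟨
    ∣ S ∣ * n         ≡⟨ ∣cylinder∣ n S ⟨
    ∣ cylinder n S ∣  ≤⟨ minimalKTDS⇒∣S∣≤Γ (G □ H) (cylinder-isMinimalKTDS dom external) ⟩
    Γ k (G □ H)       ∎
    where open ≤-Reasoning

mainTheorem12 : ∀ {m n : ℕ} (k : ℕ) → k ≥ 2 →
    (G : Graph m) → ΓExternal k G → δ G ≥ k →
    (H : Graph n) →
    (δ H ≥ k + 1 → Γ k (G □ H) ≥ Γ k G * (Γ k H + δ H ∸ k))
    ×
    (Regular k H → Γ k (G □ H) ≥ Γ k G * Γ k H)
mainTheorem12 {n = n} k _ G ext _ H =
  -- The second factor parses as `(Γ k H + δ H) ∸ k`, so subtracting `k` from the bound `n + k`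
  -- leaves `n`.
  (λ _ → bound (≤-trans (∸-monoˡ-≤ k (Γ+δ≤n+k H)) (≤-reflexive (m+n∸n≡m n k)))) ,
  -- The second factor is now `Γ k H` alone, and no vertex set exceeds `n`.
  (λ _ → bound (Γ≤ H λ {S} _ → ∣p∣≤n S))
  where
  bound : ∀ {b} → b ≤ n → Γ k G * b ≤ Γ k (G □ H)
  bound b≤n = ≤-trans (*-monoʳ-≤ (Γ k G) b≤n) (ΓExternal⇒Γ*n≤Γ□ G H ext)
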